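{- Let $G=(V,E)$ be a graph and let $v\in V$. Then $$\gamma_{\rm esp}(G)-1\le \gamma_{\rm esp}(G-v)\le \gamma_{\rm esp}(G)+\deg_G(v)-1.$$
   Context: Graphs are finite, simple and undirected. For a graph $G=(V,E)$ and $S\subseteq V$, write $\overline{S}=V\setminus S$, and let $N(v)$ be the open neighbourhood of $v$. A set $S \subseteq V$ is an end super dominating set (ESD-set) of $G$ if for every $u\in\overline{S}$ there exists $v\in S$ with $N(v)\cap\overline{S}=\{u\}$, and moreover $\deg(u)\ge 2$ for every $u\in\overline{S}$. The end super domination number $\gamma_{\rm esp}(G)$ is the minimum cardinality of an ESD-set of $G$. $G-v$ denotes the graph obtained from $G$ by deleting the vertex $v$ and all edges incident with $v$; it need not be connected. -}

module Defs where

open import Level using (0ℓ)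
open import Data.Nat using (ℕ; suc; _≤_; _<_; _≤?_; _<?_)
open import Data.Nat.Properties using (≮⇒≥)
open import Data.Nat.Induction using (<-wellFounded)
open import Induction.WellFounded using (Acc; acc)
open import Data.Bool.Properties using () renaming (_≟_ to _≟ᵇ_)
open import Data.Fin using (Fin; punchIn)
open import Data.Fin.Properties using (all?; any?)
open import Data.Fin.Subset using (Subset; _∈_; _∩_; ∁; ⁅_⁆; ⊤; ∣_∣)
open import Data.Fin.Subset.Properties
  using (_∈?_; anySubset?; ∈⊤; x∈∁p⇒x∉p)
open import Data.Product using (_×_; _,_; ∃; proj₁)
open import Data.Vec using (tabulate)
open import Data.Vec.Properties using (≡-dec)
open import Relation.Binary using (Rel; Symmetric; Irreflexive; Decidable)
open import Relation.Binary.PropositionalEquality using (_≡_; refl)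
open import Relation.Nullary using (does; yes; no; contradiction)
open import Relation.Nullary.Decidable using (_×-dec_; _→-dec_)
import Relation.Unary as U

-- Finite simple undirected graphs with vertex set Fin n. Adjacency is
-- required to be decidable, which is automatic classically.
record Graph (n : ℕ) : Set₁ where
  field
    _~_      : Rel (Fin n) 0ℓ
    _~?_     : Decidable _~_
    ~-sym    : Symmetric _~_
    ~-irrefl : Irreflexive _≡_ _~_

module _ {n : ℕ} (G : Graph n) where
  open Graph G

  N : Fin n → Subset n
  N v = tabulate (λ w → does (v ~? w))

  deg : Fin n → ℕ
  deg v = ∣ N v ∣

  IsESD : Subset n → Set
  IsESD S = ∀ u → u ∈ ∁ S →
    (∃ λ v → v ∈ S × N v ∩ ∁ S ≡ ⁅ u ⁆) × 2 ≤ deg u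

  isESD? : U.Decidable IsESD
  isESD? S = all? λ u → (u ∈? ∁ S) →-dec
    (any? (λ v → (v ∈? S) ×-dec ≡-dec _≟ᵇ_ (N v ∩ ∁ S) ⁅ u ⁆)
      ×-dec (2 ≤? deg u))

  ⊤-isESD : IsESD ⊤
  ⊤-isESD u u∈∁⊤ = contradiction ∈⊤ (x∈∁p⇒x∉p u∈∁⊤)

-- The surviving vertices w ≠ v of G are renumbered by the order-preserving
-- injection punchIn v : Fin n → Fin (suc n), whose image omits exactly v.
delete : ∀ {n} → Graph (suc n) → Fin (suc n) → Graph n
delete G v = record
  { _~_      = λ x y → punchIn v x ~ punchIn v y
  ; _~?_     = λ x y → punchIn v x ~? punchIn v y
  ; ~-sym    = ~-sym
  ; ~-irrefl = λ { refl → ~-irrefl refl }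
  }
  where open Graph G

minimumSubset : ∀ {n} {P : Subset n → Set} → U.Decidable P → ∃ P →
  ∃ λ S → P S × (∀ T → P T → ∣ S ∣ ≤ ∣ T ∣)
minimumSubset {n} {P} P? (S₀ , p₀) = go S₀ p₀ (<-wellFounded ∣ S₀ ∣)
  where
  go : ∀ S → P S → Acc _<_ ∣ S ∣ →
    ∃ λ S → P S × (∀ T → P T → ∣ S ∣ ≤ ∣ T ∣)
  go S p (acc rec) with anySubset? (λ T → P? T ×-dec (∣ T ∣ <? ∣ S ∣))
  ... | yes (T , q , T<S) = go T q (rec T<S)
  ... | no ¬smaller = S , p , λ T q → ≮⇒≥ (λ T<S → ¬smaller (T , q , T<S))

minimumESD : ∀ {n} (G : Graph n) →
  ∃ λ S → IsESD G S × (∀ T → IsESD G T → ∣ S ∣ ≤ ∣ T ∣)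
minimumESD G = minimumSubset (isESD? G) (⊤ , ⊤-isESD G)

γesp : ∀ {n} → Graph n → ℕ
γesp G = ∣ proj₁ (minimumESD G) ∣

{-# OPTIONS --safe #-}
module Submission where

-- Adding v to an ESD-set of G - v leaves the complement unchanged, which gives
-- the lower bound. Conversely, if S is an ESD-set of G, then (S ∪ N(v)) ∖ {v} is
-- one of G - v: a vertex u outside it is not adjacent to v, so it keeps its
-- degree, and the vertex isolating it is not v. This set has at most
-- |S| + deg v - 1 elements, since either v ∈ S is dropped, or S meets N(v).

open import Defs
open import Data.Nat using (ℕ; suc; z≤n; s≤s)
import Data.Nat as ℕ
import Data.Nat.Properties as ℕ
open import Data.Fin using (Fin; zero; suc; punchIn; punchOut; _≟_)
open import Data.Fin.Properties using (punchIn-injective; punchIn-punchOut)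
open import Data.Fin.Subset
  using (Subset; inside; outside; _∈_; _∉_; Nonempty; _∩_; _∪_; ∁; ⁅_⁆; ∣_∣)
open import Data.Fin.Subset.Properties
  using ( _∈?_; ∣p∣≤∣x∷p∣; x∈p⇒∣p-x∣<∣p∣; ⊆-antisym; x∈⁅x⁆; x∈⁅y⁆⇒x≡y
        ; x∈p∩q⁺; x∈p∩q⁻; x∈p∪q⁺; x∉p⇒x∈∁p; x∈∁p⇒x∉p)
open import Data.Integer using (+_; _+_; _-_; _≤_; 1ℤ; -≤+; +≤+)
open import Data.Product using (_×_; _,_; ∃; proj₁; proj₂)
open import Data.Sum using (_⊎_; inj₁; inj₂)
open import Data.Vec using (Vec; []; _∷_; lookup; tabulate; insertAt; removeAt)
open import Data.Vec.Properties
  using ( []=⇒lookup; lookup⇒[]=; lookup∘tabulate; insertAt-lookup; insertAt-punchIn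
        ; removeAt-insertAt)
open import Function using (_∘_)
open import Relation.Binary.PropositionalEquality
  using (_≡_; refl; sym; trans; cong; subst)
open import Relation.Nullary using (¬_; does; yes; no; contradiction)
open import Relation.Nullary.Decidable using (dec-true)

private
  variable
    n : ℕ
    A : Set

lookup-removeAt : (xs : Vec A (suc n)) (i : Fin (suc n)) (j : Fin n) →
  lookup (removeAt xs i) j ≡ lookup xs (punchIn i j)
lookup-removeAt (_ ∷ _)          zero    _       = refl
lookup-removeAt (_ ∷ _ ∷ _)      (suc _) zero    = refl
lookup-removeAt (_ ∷ xs@(_ ∷ _)) (suc i) (suc j) = lookup-removeAt xs i j

removeAt-tabulate : (f : Fin (suc n) → A) (i : Fin (suc n)) →
  removeAt (tabulate f) i ≡ tabulate (f ∘ punchIn i)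
removeAt-tabulate {n = _}     f zero    = refl
removeAt-tabulate {n = suc _} f (suc i) = cong (f zero ∷_) (removeAt-tabulate (f ∘ suc) i)

∈-removeAt⁺ : (p : Subset (suc n)) (i : Fin (suc n)) {j : Fin n} →
  punchIn i j ∈ p → j ∈ removeAt p i
∈-removeAt⁺ p i j∈p = lookup⇒[]= _ _ (trans (lookup-removeAt p i _) ([]=⇒lookup j∈p))

-- Keeping the entry at `i` as a head bit avoids a case split on membership: the three size lemmas
-- for `removeAt` below follow by bounding or evaluating that bit.
∣lookup∷removeAt∣≡∣p∣ : (p : Subset (suc n)) (i : Fin (suc n)) →
  ∣ lookup p i ∷ removeAt p i ∣ ≡ ∣ p ∣
∣lookup∷removeAt∣≡∣p∣ (_ ∷ _) zero = refl
∣lookup∷removeAt∣≡∣p∣ (b ∷ p@(_ ∷ _)) (suc i)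
  with b | lookup p i | ∣lookup∷removeAt∣≡∣p∣ p i
... | outside | outside | eq = eq
... | outside | inside  | eq = eq
... | inside  | outside | eq = cong suc eq
... | inside  | inside  | eq = cong suc eq

∣removeAt∣≤∣p∣ : (p : Subset (suc n)) (i : Fin (suc n)) → ∣ removeAt p i ∣ ℕ.≤ ∣ p ∣
∣removeAt∣≤∣p∣ p i =
  subst (∣ removeAt p i ∣ ℕ.≤_) (∣lookup∷removeAt∣≡∣p∣ p i)
    (∣p∣≤∣x∷p∣ (lookup p i) (removeAt p i))

x∈p⇒1+∣removeAt∣≡∣p∣ : (p : Subset (suc n)) {i : Fin (suc n)} →
  i ∈ p → suc ∣ removeAt p i ∣ ≡ ∣ p ∣
x∈p⇒1+∣removeAt∣≡∣p∣ p {i} i∈p =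
  subst (λ b → ∣ b ∷ removeAt p i ∣ ≡ ∣ p ∣) ([]=⇒lookup i∈p) (∣lookup∷removeAt∣≡∣p∣ p i)

x∉p⇒∣removeAt∣≡∣p∣ : (p : Subset (suc n)) {i : Fin (suc n)} →
  i ∉ p → ∣ removeAt p i ∣ ≡ ∣ p ∣
x∉p⇒∣removeAt∣≡∣p∣ p {i} i∉p with lookup p i in eq | ∣lookup∷removeAt∣≡∣p∣ p i
... | outside | ∣p∣≡ = ∣p∣≡
... | inside  | _    = contradiction (lookup⇒[]= i p eq) i∉p

∣insertAt-inside∣ : (p : Subset n) (i : Fin (suc n)) → ∣ insertAt p i inside ∣ ≡ suc ∣ p ∣
∣insertAt-inside∣ p i = trans
  (sym (x∈p⇒1+∣removeAt∣≡∣p∣ (insertAt p i inside) (lookup⇒[]= i _ (insertAt-lookup p i inside))))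
  (cong (suc ∘ ∣_∣) (removeAt-insertAt p i inside))

-- An exact count, so that it yields both the union bound and its strict form for overlapping sets.
∣p∪q∣+∣p∩q∣≡∣p∣+∣q∣ : (p q : Subset n) → ∣ p ∪ q ∣ ℕ.+ ∣ p ∩ q ∣ ≡ ∣ p ∣ ℕ.+ ∣ q ∣
∣p∪q∣+∣p∩q∣≡∣p∣+∣q∣ []            []            = refl
∣p∪q∣+∣p∩q∣≡∣p∣+∣q∣ (outside ∷ p) (outside ∷ q) = ∣p∪q∣+∣p∩q∣≡∣p∣+∣q∣ p q
∣p∪q∣+∣p∩q∣≡∣p∣+∣q∣ (inside  ∷ p) (outside ∷ q) = cong suc (∣p∪q∣+∣p∩q∣≡∣p∣+∣q∣ p q)
∣p∪q∣+∣p∩q∣≡∣p∣+∣q∣ (outside ∷ p) (inside  ∷ q) =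
  trans (cong suc (∣p∪q∣+∣p∩q∣≡∣p∣+∣q∣ p q)) (sym (ℕ.+-suc ∣ p ∣ ∣ q ∣))
∣p∪q∣+∣p∩q∣≡∣p∣+∣q∣ (inside  ∷ p) (inside  ∷ q) = cong suc (trans
  (ℕ.+-suc ∣ p ∪ q ∣ ∣ p ∩ q ∣)
  (trans (cong suc (∣p∪q∣+∣p∩q∣≡∣p∣+∣q∣ p q)) (sym (ℕ.+-suc ∣ p ∣ ∣ q ∣))))

∣p∪q∣≤∣p∣+∣q∣ : (p q : Subset n) → ∣ p ∪ q ∣ ℕ.≤ ∣ p ∣ ℕ.+ ∣ q ∣
∣p∪q∣≤∣p∣+∣q∣ p q =
  subst (∣ p ∪ q ∣ ℕ.≤_) (∣p∪q∣+∣p∩q∣≡∣p∣+∣q∣ p q) (ℕ.m≤m+n ∣ p ∪ q ∣ ∣ p ∩ q ∣)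

p∩q≢∅⇒∣p∪q∣<∣p∣+∣q∣ : (p q : Subset n) → Nonempty (p ∩ q) →
  ∣ p ∪ q ∣ ℕ.< ∣ p ∣ ℕ.+ ∣ q ∣
p∩q≢∅⇒∣p∪q∣<∣p∣+∣q∣ p q (_ , x∈p∩q) =
  subst (∣ p ∪ q ∣ ℕ.<_) (∣p∪q∣+∣p∩q∣≡∣p∣+∣q∣ p q)
    -- Removing `x` strictly shrinks `p ∩ q`, which shows that its size is positive.
    (ℕ.m<m+n ∣ p ∪ q ∣ (ℕ.≤-<-trans z≤n (x∈p⇒∣p-x∣<∣p∣ x∈p∩q)))

≡⊎punchIn : (i j : Fin (suc n)) → j ≡ i ⊎ ∃ λ k → j ≡ punchIn i k
≡⊎punchIn i j with i ≟ j
... | yes i≡j = inj₁ (sym i≡j)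
... | no  i≢j = inj₂ (punchOut i≢j , sym (punchIn-punchOut i≢j))

module _ (G : Graph n) where
  open Graph G

  ∈N⁺ : ∀ {v w} → v ~ w → w ∈ N G v
  ∈N⁺ {v} {w} v~w = lookup⇒[]= w _ (trans (lookup∘tabulate _ w) (dec-true (v ~? w) v~w))

  ∈N⁻ : ∀ {v w} → w ∈ N G v → v ~ w
  ∈N⁻ {v} {w} w∈N with v ~? w | trans (sym (lookup∘tabulate _ w)) ([]=⇒lookup w∈N)
  ... | yes v~w | _ = v~w
  ... | no  _   | ()

  -- Elementwise form of `N G v ∩ ∁ S ≡ ⁅ u ⁆`, with `u ∉ S` kept separate. Adjacency in
  -- `delete G v` unfolds to adjacency in `G`, so this form passes between the two graphs where an
  -- equation of subsets would not.
  Isolates : Subset n → Fin n → Fin n → Set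
  Isolates S v u = v ~ u × (∀ {w} → v ~ w → w ∉ S → w ≡ u)

  isolates⇒N∩∁≡⁅⁆ : ∀ {S v u} → u ∉ S → Isolates S v u → N G v ∩ ∁ S ≡ ⁅ u ⁆
  isolates⇒N∩∁≡⁅⁆ {S} {v} {u} u∉S (v~u , unique) = ⊆-antisym
    (λ w∈ → let w∈N , w∈∁S = x∈p∩q⁻ _ _ w∈ in
      subst (_∈ ⁅ u ⁆) (sym (unique (∈N⁻ w∈N) (x∈∁p⇒x∉p w∈∁S))) (x∈⁅x⁆ u))
    (λ w∈ → subst (_∈ N G v ∩ ∁ S) (sym (x∈⁅y⁆⇒x≡y u w∈))
      (x∈p∩q⁺ (∈N⁺ v~u , x∉p⇒x∈∁p u∉S)))

  N∩∁≡⁅⁆⇒isolates : ∀ {S v u} → N G v ∩ ∁ S ≡ ⁅ u ⁆ → Isolates S v u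
  N∩∁≡⁅⁆⇒isolates {u = u} eq =
    ∈N⁻ (proj₁ (x∈p∩q⁻ _ _ (subst (u ∈_) (sym eq) (x∈⁅x⁆ u)))) ,
    λ v~w w∉S → x∈⁅y⁆⇒x≡y u (subst (_ ∈_) eq (x∈p∩q⁺ (∈N⁺ v~w , x∉p⇒x∈∁p w∉S)))

  γesp≤ : ∀ {S} → IsESD G S → γesp G ℕ.≤ ∣ S ∣
  γesp≤ = proj₂ (proj₂ (minimumESD G)) _

module _ (G : Graph (suc n)) (v : Fin (suc n)) where
  open Graph G

  N-delete : ∀ u → removeAt (N G (punchIn v u)) v ≡ N (delete G v) u
  N-delete u = removeAt-tabulate (λ w → does (punchIn v u ~? w)) v

  deg-delete-≤ : ∀ u → deg (delete G v) u ℕ.≤ deg G (punchIn v u)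
  deg-delete-≤ u = subst (λ p → ∣ p ∣ ℕ.≤ deg G (punchIn v u)) (N-delete u)
    (∣removeAt∣≤∣p∣ (N G (punchIn v u)) v)

  -- By symmetry `v` is not a neighbour of `punchIn v u`, so the dropped entry was not counted.
  deg-delete-≡ : ∀ u → ¬ (v ~ punchIn v u) → deg (delete G v) u ≡ deg G (punchIn v u)
  deg-delete-≡ u v≁u = subst (λ p → ∣ p ∣ ≡ deg G (punchIn v u)) (N-delete u)
    (x∉p⇒∣removeAt∣≡∣p∣ (N G (punchIn v u)) (v≁u ∘ ~-sym ∘ ∈N⁻ G))

  insertAt-isESD : ∀ {S} → IsESD (delete G v) S → IsESD G (insertAt S v inside)
  insertAt-isESD {S} esd = esd⁺
    where
    S⁺ = insertAt S v inside

    v∈S⁺ : v ∈ S⁺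
    v∈S⁺ = lookup⇒[]= v S⁺ (insertAt-lookup S v inside)

    ∈S⁺ : ∀ {x} → x ∈ S → punchIn v x ∈ S⁺
    ∈S⁺ x∈S = lookup⇒[]= _ S⁺ (trans (insertAt-punchIn S v inside _) ([]=⇒lookup x∈S))

    isolates⁺ : ∀ {w u} → Isolates (delete G v) S w u →
      Isolates G S⁺ (punchIn v w) (punchIn v u)
    isolates⁺ {w} {u} (w~u , unique) = w~u , unique⁺
      where
      unique⁺ : ∀ {x} → punchIn v w ~ x → x ∉ S⁺ → x ≡ punchIn v u
      unique⁺ {x} w~x x∉S⁺ with ≡⊎punchIn v x
      -- The vertex `v` may be a new neighbour of `punchIn v w`, but it lies in `S⁺` and so does not
      -- spoil uniqueness.
      ... | inj₁ refl       = contradiction v∈S⁺ x∉S⁺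
      ... | inj₂ (_ , refl) = cong (punchIn v) (unique w~x (x∉S⁺ ∘ ∈S⁺))

    esd⁺ : IsESD G S⁺
    esd⁺ u u∈∁S⁺ with ≡⊎punchIn v u
    ... | inj₁ refl       = contradiction v∈S⁺ (x∈∁p⇒x∉p u∈∁S⁺)
    ... | inj₂ (u , refl) =
      let u∉S⁺                   = x∈∁p⇒x∉p u∈∁S⁺
          (w , w∈S , eq) , 2≤deg = esd u (x∉p⇒x∈∁p (u∉S⁺ ∘ ∈S⁺))
      in (punchIn v w , ∈S⁺ w∈S ,
          isolates⇒N∩∁≡⁅⁆ G u∉S⁺ (isolates⁺ (N∩∁≡⁅⁆⇒isolates (delete G v) eq))) ,
         ℕ.≤-trans 2≤deg (deg-delete-≤ u)

  removeAt-isESD : ∀ {S} → IsESD G S → IsESD (delete G v) (removeAt (S ∪ N G v) v)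
  removeAt-isESD {S} esd u u∈∁T = isolated , 2≤deg
    where
    T = removeAt (S ∪ N G v) v

    ∈T : ∀ {x} → punchIn v x ∈ S ⊎ punchIn v x ∈ N G v → x ∈ T
    ∈T = ∈-removeAt⁺ (S ∪ N G v) v ∘ x∈p∪q⁺

    u∉T : u ∉ T
    u∉T = x∈∁p⇒x∉p u∈∁T

    v≁u : ¬ (v ~ punchIn v u)
    v≁u = u∉T ∘ ∈T ∘ inj₂ ∘ ∈N⁺ G

    esd-u = esd (punchIn v u) (x∉p⇒x∈∁p (u∉T ∘ ∈T ∘ inj₁))

    2≤deg : 2 ℕ.≤ deg (delete G v) u
    2≤deg = subst (2 ℕ.≤_) (sym (deg-delete-≡ u v≁u)) (proj₂ esd-u)

    isolated : ∃ λ w → w ∈ T × N (delete G v) w ∩ ∁ T ≡ ⁅ u ⁆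
    isolated with w , w∈S , eq ← proj₁ esd-u
             with w~u , unique ← N∩∁≡⁅⁆⇒isolates G eq
             with ≡⊎punchIn v w
    -- If `v` itself isolated `u`, then `u` would be a neighbour of `v` and hence in `T`.
    ... | inj₁ refl       = contradiction w~u v≁u
    ... | inj₂ (w , refl) = w , ∈T (inj₁ w∈S) ,
      isolates⇒N∩∁≡⁅⁆ (delete G v) u∉T
        -- `T` contains every surviving vertex of `S`, so a vertex outside `T` is also outside `S`
        -- and the old uniqueness applies.
        (w~u , λ w~x x∉T → punchIn-injective v _ _ (unique w~x (x∉T ∘ ∈T ∘ inj₁)))

  ∣removeAt∣<∣S∣+deg : ∀ {S} → IsESD G S →
    ∣ removeAt (S ∪ N G v) v ∣ ℕ.< ∣ S ∣ ℕ.+ deg G v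
  ∣removeAt∣<∣S∣+deg {S} esd with v ∈? S
  -- Dropping `v` from the union already gives strictness, so the plain union bound suffices.
  ... | yes v∈S = ℕ.≤-trans
    (ℕ.≤-reflexive (x∈p⇒1+∣removeAt∣≡∣p∣ (S ∪ N G v) (x∈p∪q⁺ (inj₁ v∈S))))
    (∣p∪q∣≤∣p∣+∣q∣ S (N G v))
  -- The vertex of S that isolates v is itself a neighbour of v, so S and N G v overlap.
  ... | no v∉S =
    let (w , w∈S , eq) , _ = esd v (x∉p⇒x∈∁p v∉S)
        w~v , _            = N∩∁≡⁅⁆⇒isolates G eq
    in ℕ.≤-<-trans (∣removeAt∣≤∣p∣ (S ∪ N G v) v)
         (p∩q≢∅⇒∣p∪q∣<∣p∣+∣q∣ S (N G v) (w , x∈p∩q⁺ (w∈S , ∈N⁺ G (~-sym w~v))))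

-- Integer subtraction does not truncate: `m = 0` gives `-1` on the left and is a case of its own.
m≤1+n⇒m-1≤n : ∀ {m n} → m ℕ.≤ suc n → + m - 1ℤ ≤ + n
m≤1+n⇒m-1≤n {ℕ.zero} _         = -≤+
m≤1+n⇒m-1≤n {suc _}  (s≤s m≤n) = +≤+ m≤n

m<n⇒m≤n-1 : ∀ {m n} → m ℕ.< n → + m ≤ + n - 1ℤ
m<n⇒m≤n-1 (s≤s m≤n) = +≤+ m≤n

proposition6p4 : ∀ {n : ℕ} (G : Graph (suc n)) (v : Fin (suc n)) →
    (+ γesp G - 1ℤ ≤ + γesp (delete G v)) ×
    (+ γesp (delete G v) ≤ + γesp G + + deg G v - 1ℤ)
proposition6p4 G v =
  m≤1+n⇒m-1≤n (ℕ.≤-trans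
    (γesp≤ G (insertAt-isESD G v (proj₁ (proj₂ (minimumESD (delete G v))))))
    (ℕ.≤-reflexive (∣insertAt-inside∣ (proj₁ (minimumESD (delete G v))) v))) ,
  -- The integer sum `+ γesp G + + deg G v` computes to the image of the natural sum, where `γesp G`
  -- is the size of the minimum set witnessed by `S-esd`.
  m<n⇒m≤n-1 (ℕ.≤-<-trans
    (γesp≤ (delete G v) (removeAt-isESD G v S-esd))
    (∣removeAt∣<∣S∣+deg G v S-esd))
  where S-esd = proj₁ (proj₂ (minimumESD G))
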